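{- Let $b(0)=1$ and $b(2m-1)=b(2m)=(-1)^m\binom{2m}{m}$ for $m\ge1$, so that $(b(n))_{n\ge0}=(1,-2,-2,6,6,-20,-20,\dots)$. Let $(\bar b(n))_{n\ge 0}=(b(0),0,b(1),0,b(2),0,\dots)$, i.e. $\bar b(2n)=b(n)$ and $\bar b(2n+1)=0$ for $n\ge 0$. Set $\bar D_0(n)=\det(\bar b(i+j))_{i,j=0}^{n-1}$ and $\bar D_1(n)=\det(\bar b(i+j+1))_{i,j=0}^{n-1}$. Then for all integers $n\ge 0$ $$\bar D_0(4n)=2^{4n-1}L_{2n}L_{2n+1},\quad \bar D_0(4n+1)=2^{4n}L_{2n+1}^2,$$ $$\bar D_0(4n+2)=-2^{4n+1}L_{2n+1}^2,\quad \bar D_0(4n+3)=2^{4n+2}L_{2n+1}L_{2n+2},$$ and $$\bar D_1(2n+1)=0,\quad \bar D_1(4n)=2^{4n}L_{2n+1}^2,\quad \bar D_1(4n+2)=-2^{4n+2}L_{2n+1}^2.$$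
   Context: $L_n$ is the Lucas sequence $L_0=2$, $L_1=1$, $L_n=L_{n-1}+L_{n-2}$. The determinant of the empty ($0\times 0$) matrix is $1$. -}

module Defs where

open import Data.Nat.Base as ℕ using (ℕ; zero; suc; ⌈_/2⌉)
open import Data.Nat.Combinatorics using (_C_)
open import Data.Nat.Properties using (m^n≢0)
open import Data.Integer.Base using (ℤ; +_; -[1+_]; 0ℤ; 1ℤ; -1ℤ; _+_; _*_; _^_)
open import Data.Integer.Properties using (+-0-monoid)
open import Data.Rational.Base using (ℚ; _/_)
open import Data.Fin.Base using (Fin; zero; suc; toℕ)
open import Data.Vec.Functional using (Vector; removeAt)
open import Algebra.Properties.Monoid.Sum +-0-monoid using (sum-syntax)

Matrix : ℕ → Set
Matrix n = Vector (Vector ℤ n) n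

-- Laplace expansion along the first row.
det : ∀ n → Matrix n → ℤ
det zero    A = 1ℤ
det (suc n) A =
  ∑[ j < suc n ]
    (-1ℤ ^ toℕ j * A zero j * det n (λ i → removeAt (A (suc i)) j))

L : ℕ → ℤ
L 0             = + 2
L 1             = + 1
L (suc (suc n)) = L (suc n) + L n

-- Both k = 2m - 1 and k = 2m have ⌈ k /2⌉ = m.
b : ℕ → ℤ
b zero      = 1ℤ
b k@(suc _) = -1ℤ ^ m * + ((2 ℕ.* m) C m)
  where
  m : ℕ
  m = ⌈ k /2⌉

interleaveZeros : (ℕ → ℤ) → ℕ → ℤ
interleaveZeros a 0             = a 0
interleaveZeros a 1             = 0ℤ
interleaveZeros a (suc (suc k)) = interleaveZeros (λ n → a (suc n)) k

b̄ : ℕ → ℤ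
b̄ = interleaveZeros b

D̄₀ : ℕ → ℤ
D̄₀ n = det n (λ i j → b̄ (toℕ i ℕ.+ toℕ j))

D̄₁ : ℕ → ℤ
D̄₁ n = det n (λ i j → b̄ (toℕ i ℕ.+ toℕ j ℕ.+ 1))

toℚ : ℤ → ℚ
toℚ i = i / 1

-- Powers of 2 with integer exponent: the exponent 4n - 1 is -1 at n = 0.
2^ : ℤ → ℚ
2^ (+ k)    = toℚ (+ (2 ℕ.^ k))
2^ -[1+ k ] = _/_ 1ℤ (2 ℕ.^ suc k) {{m^n≢0 2 (suc k)}}

{-# OPTIONS --safe #-}
-- Write c(n) for the constant term of (t - 1/t)^n, which is 0 for odd n and (-1)^m binom(2m, m)
-- for n = 2m. Then b(n) = c(n) + c(n + 1), so b is the moment sequence of the functional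
-- p ↦ CT((1 + x) p(x)) with x = t - 1/t. The Lucas polynomials l_k(x) = t^k + (-1/t)^k are
-- orthogonal for CT, and their values L_k = (-1)^k l_k(-1) make Christoffel's formula for the
-- weights 1 + x and x (1 + x) explicit. Evaluated at x = y², the resulting polynomials are the
-- orthogonal polynomials q_n of b̄. Replacing the last column of a Hankel matrix by the
-- combination of columns given by q_n yields D̄₀(n+1)/D̄₀(n), and, since the last column of the
-- shifted matrix can be traded for q_n(0) times the first column of the unshifted one,
-- also D̄₁(n)/D̄₀(n).
module Submission where

open import Defs
open import Algebra.Properties.Monoid.Sum using (sum-cong-≗)
open import Algebra.Properties.Semiring.Sum using (*-distribˡ-sum)
open import Data.Fin.Base using (Fin; zero; suc; toℕ)
open import Data.Integer.Base using (ℤ; 1ℤ; -1ℤ; _+_; +_; 0ℤ; -_; _-_; _*_; _^_; +<+; >-nonZero)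
open import Data.Integer.Properties as ℤ using (+-0-monoid; +-*-semiring)
import Data.Integer.Base as ℤ using (_<_)
open import Data.Integer.Tactic.RingSolver using (solve-∀)
open import Data.List.Base using (List; []; _∷_; _++_; map; tabulate; applyUpTo; length)
open import Data.List.Properties using (++-identityʳ; length-applyUpTo; map-++; map-tabulate; applyUpTo-∷ʳ)
open import Data.Nat.Base as ℕ using (ℕ; zero; suc; _≤_; _<_; ⌈_/2⌉; z<s; s<s)
open import Data.Nat.Combinatorics using (_C_; nCk≡nC[n∸k]; nCk+nC[k+1]≡[n+1]C[k+1])
import Data.Nat.Properties as ℕ
open import Data.Product.Base using (_×_; _,_)
open import Data.Rational.Base as ℚ using ()
import Data.Rational.Properties as ℚ
open import Data.Rational.Unnormalised.Base as ℚᵘ using (mkℚᵘ)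
import Data.Rational.Unnormalised.Properties as ℚᵘ
open import Data.Vec.Functional using (removeAt)
open import Algebra.Properties.Monoid.Sum +-0-monoid using (sum-syntax)
open import Function.Base using (_∘_)
open import Relation.Binary.PropositionalEquality

open ≡-Reasoning

-- Determinants as functions of lists of columns

Column : Set
Column = ℕ → ℤ

-- Deletes the first row. Columns are infinite sequences of which `D n` reads n entries, so minors
-- keep the type.
tail : Column → Column
tail c = c ∘ suc

-- Laplace expansion along the first row, with `f` giving the minors. The columns already passed
-- over are absorbed into `f`, and the nested subtractions produce the alternating signs.
expand : (List Column → ℤ) → List Column → ℤ
expand f []       = 0ℤ
expand f (c ∷ cs) = c 0 * f cs - expand (f ∘ (c ∷_)) cs

-- The value 0 on a list of the wrong length keeps D n alternating for every n.
D : ℕ → List Column → ℤ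
D zero    []      = 1ℤ
D zero    (_ ∷ _) = 0ℤ
D (suc n) cs      = expand (D n ∘ map tail) cs

-- Removing index `suc j` keeps `v zero` in front, which is what `f ∘ (v zero ∷_)` records; the
-- extra factor -1 in the sign becomes the subtraction.
expand-tabulate : ∀ n f (v : Fin (suc n) → Column) →
  (∑[ j < suc n ] (-1ℤ ^ toℕ j * v j 0 * f (tabulate (removeAt v j)))) ≡ expand f (tabulate v)
expand-tabulate zero f v = lem (v zero 0) (f [])
  where
  lem : ∀ x y → 1ℤ * x * y + 0ℤ ≡ x * y - 0ℤ
  lem = solve-∀
expand-tabulate (suc n) f v = begin
  1ℤ * v zero 0 * y + ∑[ j < suc n ] (-1ℤ ^ toℕ (suc j) * v (suc j) 0 * g j)
    ≡⟨ cong (λ z → 1ℤ * v zero 0 * y + z) (trans (sum-cong-≗ +-0-monoid λ j → pull (-1ℤ ^ toℕ j) (v (suc j) 0) (g j))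
         (sym (*-distribˡ-sum +-*-semiring -1ℤ (λ j → -1ℤ ^ toℕ j * v (suc j) 0 * g j)))) ⟩
  1ℤ * v zero 0 * y + -1ℤ * (∑[ j < suc n ] (-1ℤ ^ toℕ j * v (suc j) 0 * g j))
    ≡⟨ cong (λ z → 1ℤ * v zero 0 * y + -1ℤ * z) (expand-tabulate n (f ∘ (v zero ∷_)) (v ∘ suc)) ⟩
  1ℤ * v zero 0 * y + -1ℤ * expand (f ∘ (v zero ∷_)) (tabulate (v ∘ suc))
    ≡⟨ lem (v zero 0) y _ ⟩
  v zero 0 * y - expand (f ∘ (v zero ∷_)) (tabulate (v ∘ suc)) ∎
  where
  y : ℤ
  y = f (tabulate (v ∘ suc))
  g : Fin (suc n) → ℤ
  g j = f (v zero ∷ tabulate (removeAt (v ∘ suc) j))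
  pull : ∀ s x z → -1ℤ * s * x * z ≡ -1ℤ * (s * x * z)
  pull = solve-∀
  lem : ∀ x y z → 1ℤ * x * y + -1ℤ * z ≡ x * y - z
  lem = solve-∀

det≡D : ∀ n (v : Fin n → Column) → det n (λ i j → v j (toℕ i)) ≡ D n (tabulate v)
det≡D zero    v = refl
det≡D (suc n) v = trans
  (sum-cong-≗ +-0-monoid λ j → cong (-1ℤ ^ toℕ j * v j 0 *_)
    (trans (det≡D n (tail ∘ removeAt v j)) (cong (D n) (sym (map-tabulate (removeAt v j) tail)))))
  (expand-tabulate n (D n ∘ map tail) v)

-- Alternating multilinear functions of the columns

-- The hypothesis of `linear` is pointwise, so that it also lets pointwise equal columns be
-- exchanged without function extensionality. Adjacent columns suffice in `repeat`, since `swap` and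
-- `rotate` reach the others.
record Alternating (f : List Column → ℤ) : Set where
  field
    linear : ∀ pre {w u v} α β post → (∀ i → w i ≡ α * u i + β * v i) →
             f (pre ++ w ∷ post) ≡ α * f (pre ++ u ∷ post) + β * f (pre ++ v ∷ post)
    repeat : ∀ pre c post → f (pre ++ c ∷ c ∷ post) ≡ 0ℤ

open Alternating

private variable
  f g : List Column → ℤ

prepend : ∀ c → Alternating f → Alternating (f ∘ (c ∷_))
prepend c A .linear pre = A .linear (c ∷ pre)
prepend c A .repeat pre = A .repeat (c ∷ pre)

expand-combination : ∀ α β (h : List Column → ℤ) → (∀ cs → h cs ≡ α * f cs + β * g cs) →
  ∀ cs → expand h cs ≡ α * expand f cs + β * expand g cs
expand-combination α β h eq [] = lem α β
  where
  lem : ∀ α β → 0ℤ ≡ α * 0ℤ + β * 0ℤ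
  lem = solve-∀
expand-combination {f} {g} α β h eq (c ∷ cs)
  rewrite eq cs | expand-combination {f ∘ (c ∷_)} {g ∘ (c ∷_)} α β (h ∘ (c ∷_)) (eq ∘ (c ∷_)) cs
  = lem α β (c 0) (f cs) (g cs) _ _
  where
  lem : ∀ α β c x y z w → c * (α * x + β * y) - (α * z + β * w) ≡ α * (c * x - z) + β * (c * y - w)
  lem = solve-∀

expand-scale : ∀ α (h : List Column → ℤ) → (∀ cs → h cs ≡ α * f cs) →
  ∀ cs → expand h cs ≡ α * expand f cs
expand-scale {f} α h eq cs = trans
  (expand-combination {f} {f} α 0ℤ h (λ ds → trans (eq ds) (lem (α * f ds) (f ds))) cs)
  (sym (lem (α * expand f cs) (expand f cs)))
  where
  lem : ∀ x y → x ≡ x + 0ℤ * y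
  lem = solve-∀

expand-zero : (∀ cs → f cs ≡ 0ℤ) → ∀ cs → expand f cs ≡ 0ℤ
expand-zero {f} eq cs = expand-scale {f} 0ℤ f eq cs

-- A term of the expansion either deletes the varied column, whose head is linear, or keeps it
-- inside `f`. Of two equal neighbours, the terms that delete one of them cancel, and every other
-- term keeps both.
expand-alternating : Alternating f → Alternating (expand f)
expand-alternating {f} A = record { linear = lin A ; repeat = rep A }
  where
  lin : ∀ {f} → Alternating f → ∀ pre {w u v} α β post → (∀ i → w i ≡ α * u i + β * v i) →
        expand f (pre ++ w ∷ post) ≡ α * expand f (pre ++ u ∷ post) + β * expand f (pre ++ v ∷ post)
  lin {f} A [] {w} {u} {v} α β post eq
    rewrite eq 0 | expand-combination {f ∘ (u ∷_)} {f ∘ (v ∷_)} α β (f ∘ (w ∷_)) (λ cs → A .linear [] α β cs eq) post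
    = lem α β (u 0) (v 0) (f post) _ _
    where
    lem : ∀ α β x y c z w → (α * x + β * y) * c - (α * z + β * w) ≡ α * (x * c - z) + β * (y * c - w)
    lem = solve-∀
  lin {f} A (d ∷ pre) {w} {u} {v} α β post eq
    rewrite A .linear pre α β post eq | lin (prepend d A) pre α β post eq
    = lem α β (d 0) (f (pre ++ u ∷ post)) (f (pre ++ v ∷ post)) _ _
    where
    lem : ∀ α β c x y z w → c * (α * x + β * y) - (α * z + β * w) ≡ α * (c * x - z) + β * (c * y - w)
    lem = solve-∀

  rep : ∀ {f} → Alternating f → ∀ pre c post → expand f (pre ++ c ∷ c ∷ post) ≡ 0ℤ
  rep {f} A [] c post rewrite expand-zero (A .repeat [] c) post = lem (c 0) (f (c ∷ post))
    where
    lem : ∀ x y → x * y - (x * y - 0ℤ) ≡ 0ℤ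
    lem = solve-∀
  rep A (d ∷ pre) c post rewrite A .repeat pre c post | rep (prepend d A) pre c post = lem (d 0)
    where
    lem : ∀ x → x * 0ℤ - 0ℤ ≡ 0ℤ
    lem = solve-∀

D-alternating : ∀ n → Alternating (D n)
D-alternating zero = record { linear = lin ; repeat = rep }
  where
  -- Both laws only concern lists with at least one column, where the default value 0 applies.
  nonempty : ∀ pre c post → D zero (pre ++ c ∷ post) ≡ 0ℤ
  nonempty []      c post = refl
  nonempty (_ ∷ _) c post = refl
  lin : ∀ pre {w u v} α β post → (∀ i → w i ≡ α * u i + β * v i) →
        D zero (pre ++ w ∷ post) ≡ α * D zero (pre ++ u ∷ post) + β * D zero (pre ++ v ∷ post)
  lin pre {w} {u} {v} α β post _ rewrite nonempty pre w post | nonempty pre u post | nonempty pre v post = lem α β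
    where
    lem : ∀ α β → 0ℤ ≡ α * 0ℤ + β * 0ℤ
    lem = solve-∀
  rep : ∀ pre c post → D zero (pre ++ c ∷ c ∷ post) ≡ 0ℤ
  rep pre c post = nonempty pre c (c ∷ post)
D-alternating (suc n) = expand-alternating record { linear = lin ; repeat = rep }
  where
  A = D-alternating n
  lin : ∀ pre {w u v} α β post → (∀ i → w i ≡ α * u i + β * v i) →
        D n (map tail (pre ++ w ∷ post)) ≡ α * D n (map tail (pre ++ u ∷ post)) + β * D n (map tail (pre ++ v ∷ post))
  lin pre {w} {u} {v} α β post eq
    rewrite map-++ tail pre (w ∷ post) | map-++ tail pre (u ∷ post) | map-++ tail pre (v ∷ post)
    = A .linear (map tail pre) α β (map tail post) (eq ∘ suc)
  rep : ∀ pre c post → D n (map tail (pre ++ c ∷ c ∷ post)) ≡ 0ℤ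
  rep pre c post rewrite map-++ tail pre (c ∷ c ∷ post) = A .repeat (map tail pre) (c ∘ suc) (map tail post)

-- Polarisation: expand the vanishing value at two copies of u + v.
swap : Alternating f → ∀ u v post → f (u ∷ v ∷ post) ≡ - f (v ∷ u ∷ post)
swap {f} A u v post = begin
  f (u ∷ v ∷ post)
    ≡⟨ lem (f (u ∷ u ∷ post)) (f (u ∷ v ∷ post)) (f (v ∷ u ∷ post)) (f (v ∷ v ∷ post)) ⟩
  (1ℤ * (1ℤ * f (u ∷ u ∷ post) + 1ℤ * f (u ∷ v ∷ post)) + 1ℤ * (1ℤ * f (v ∷ u ∷ post) + 1ℤ * f (v ∷ v ∷ post)))
    - f (u ∷ u ∷ post) - f (v ∷ v ∷ post) - f (v ∷ u ∷ post)
    ≡⟨ cong₂ (λ x y → x - f (u ∷ u ∷ post) - y - f (v ∷ u ∷ post)) (sym bilinear) (A .repeat [] v post) ⟩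
  f (s ∷ s ∷ post) - f (u ∷ u ∷ post) - 0ℤ - f (v ∷ u ∷ post)
    ≡⟨ cong₂ (λ x y → x - y - 0ℤ - f (v ∷ u ∷ post)) (A .repeat [] s post) (A .repeat [] u post) ⟩
  0ℤ - 0ℤ - 0ℤ - f (v ∷ u ∷ post)
    ≡⟨ lem′ (f (v ∷ u ∷ post)) ⟩
  - f (v ∷ u ∷ post) ∎
  where
  s : Column
  s i = 1ℤ * u i + 1ℤ * v i
  bilinear : f (s ∷ s ∷ post) ≡ 1ℤ * (1ℤ * f (u ∷ u ∷ post) + 1ℤ * f (u ∷ v ∷ post)) + 1ℤ * (1ℤ * f (v ∷ u ∷ post) + 1ℤ * f (v ∷ v ∷ post))
  bilinear = trans (A .linear [] 1ℤ 1ℤ (s ∷ post) λ _ → refl)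
    (cong₂ (λ x y → 1ℤ * x + 1ℤ * y) (A .linear (u ∷ []) 1ℤ 1ℤ post λ _ → refl) (A .linear (v ∷ []) 1ℤ 1ℤ post λ _ → refl))
  lem : ∀ a b c d → b ≡ (1ℤ * (1ℤ * a + 1ℤ * b) + 1ℤ * (1ℤ * c + 1ℤ * d)) - a - d - c
  lem = solve-∀
  lem′ : ∀ x → 0ℤ - 0ℤ - 0ℤ - x ≡ - x
  lem′ = solve-∀

rotate : Alternating f → ∀ u cs post → f (cs ++ u ∷ post) ≡ -1ℤ ^ length cs * f (u ∷ cs ++ post)
rotate {f} A u [] post = sym (ℤ.*-identityˡ _)
rotate {f} A u (c ∷ cs) post = begin
  f (c ∷ cs ++ u ∷ post)                          ≡⟨ rotate (prepend c A) u cs post ⟩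
  -1ℤ ^ length cs * f (c ∷ u ∷ cs ++ post)        ≡⟨ cong (-1ℤ ^ length cs *_) (swap A c u (cs ++ post)) ⟩
  -1ℤ ^ length cs * (- f (u ∷ c ∷ cs ++ post))    ≡⟨ lem (-1ℤ ^ length cs) (f (u ∷ c ∷ cs ++ post)) ⟩
  -1ℤ * -1ℤ ^ length cs * f (u ∷ c ∷ cs ++ post)  ∎
  where
  lem : ∀ s x → s * (- x) ≡ -1ℤ * s * x
  lem = solve-∀

repeat-last : Alternating f → ∀ u cs → f (u ∷ cs ++ u ∷ []) ≡ 0ℤ
repeat-last {f} A u cs = begin
  f (u ∷ cs ++ u ∷ [])                       ≡⟨ rotate (prepend u A) u cs [] ⟩
  -1ℤ ^ length cs * f (u ∷ u ∷ cs ++ [])     ≡⟨ cong (-1ℤ ^ length cs *_) (A .repeat [] u (cs ++ [])) ⟩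
  -1ℤ ^ length cs * 0ℤ                       ≡⟨ ℤ.*-zeroʳ (-1ℤ ^ length cs) ⟩
  0ℤ                                         ∎

-- The term that deletes `t` has coefficient 0, so `t` survives into every minor.
expand-last : ∀ f cs {t : Column} → t 0 ≡ 0ℤ →
  expand f (cs ++ t ∷ []) ≡ expand (λ ds → f (ds ++ t ∷ [])) cs
expand-last f []       {t} t0 rewrite t0 = lem (f [])
  where
  lem : ∀ x → 0ℤ * x - 0ℤ ≡ 0ℤ
  lem = solve-∀
expand-last f (c ∷ cs) t0 = cong (λ z → c 0 * f (cs ++ _ ∷ []) - z) (expand-last (f ∘ (c ∷_)) cs t0)

D-last-zero : ∀ n cs {t : Column} → (∀ i → i < n → t i ≡ 0ℤ) → D n (cs ++ t ∷ []) ≡ 0ℤ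
D-last-zero zero    []      t≡0 = refl
D-last-zero zero    (_ ∷ _) t≡0 = refl
D-last-zero (suc n) cs {t}  t≡0 = trans (expand-last _ cs (t≡0 0 z<s)) (expand-zero minor cs)
  where
  minor : ∀ ds → D n (map tail (ds ++ t ∷ [])) ≡ 0ℤ
  minor ds rewrite map-++ tail ds (t ∷ []) = D-last-zero n _ λ i i<n → t≡0 (suc i) (s<s i<n)

-- Each expansion strips one leading zero of `t` until only its bottom entry is left; that entry
-- sits on the diagonal, so no sign appears.
D-last : ∀ n cs {t : Column} → (∀ i → i < n → t i ≡ 0ℤ) → D (suc n) (cs ++ t ∷ []) ≡ t n * D n cs
D-last zero [] {t} _ = lem (t 0)
  where
  lem : ∀ x → x * 1ℤ - 0ℤ ≡ x * 1ℤ
  lem = solve-∀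
-- Too many columns: both sides take the default value 0.
D-last zero (c ∷ cs) {t} _
  rewrite map-++ tail cs (t ∷ []) | D-last-zero 0 (map tail cs) {t ∘ suc} (λ _ ())
        | expand-zero {λ ds → D 0 (map tail (c ∷ ds))} (λ _ → refl) (cs ++ t ∷ [])
  = lem (c 0) (t 0)
  where
  lem : ∀ x y → x * 0ℤ - 0ℤ ≡ y * 0ℤ
  lem = solve-∀
D-last (suc n) cs {t} t≡0 = trans (expand-last _ cs (t≡0 0 z<s)) (expand-scale (t (suc n)) _ minor cs)
  where
  minor : ∀ ds → D (suc n) (map tail (ds ++ t ∷ [])) ≡ t (suc n) * D n (map tail ds)
  minor ds rewrite map-++ tail ds (t ∷ []) = D-last n _ λ i i<n → t≡0 (suc i) (s<s i<n)

-- Columns are replaced one at a time by `linear` with coefficients 1 and 0.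
applyUpTo-cong : Alternating f → ∀ {h k : ℕ → Column} n → (∀ j i → h j i ≡ k j i) →
  f (applyUpTo h n) ≡ f (applyUpTo k n)
applyUpTo-cong A zero h≗k = refl
applyUpTo-cong {f} A {h} {k} (suc n) h≗k = begin
  f (h 0 ∷ hs)                          ≡⟨ A .linear [] {v = k 0} 1ℤ 0ℤ hs (λ i → trans (h≗k 0 i) (lem (k 0 i))) ⟩
  1ℤ * f (k 0 ∷ hs) + 0ℤ * f (k 0 ∷ hs) ≡⟨ lem (f (k 0 ∷ hs)) ⟨
  f (k 0 ∷ hs)                          ≡⟨ applyUpTo-cong (prepend (k 0) A) n (h≗k ∘ suc) ⟩
  f (applyUpTo k (suc n))               ∎
  where
  hs = applyUpTo (h ∘ suc) n
  lem : ∀ x → x ≡ 1ℤ * x + 0ℤ * x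
  lem = solve-∀

-- Linear combinations of columns

combination : ℕ → (ℕ → ℤ) → (ℕ → Column) → Column
combination zero    u h i = 0ℤ
combination (suc n) u h i = combination n u h i + u n * h n i

combination-uncons : ∀ n u h i →
  combination (suc n) u h i ≡ u 0 * h 0 i + combination n (u ∘ suc) (h ∘ suc) i
combination-uncons zero u h i = ℤ.+-comm 0ℤ (u 0 * h 0 i)
combination-uncons (suc n) u h i = begin
  combination (suc n) u h i + x                            ≡⟨ cong (_+ x) (combination-uncons n u h i) ⟩
  u 0 * h 0 i + combination n (u ∘ suc) (h ∘ suc) i + x    ≡⟨ ℤ.+-assoc (u 0 * h 0 i) (combination n (u ∘ suc) (h ∘ suc) i) x ⟩
  u 0 * h 0 i + (combination n (u ∘ suc) (h ∘ suc) i + x)  ∎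
  where
  x = u (suc n) * h (suc n) i

-- The shape `u j + α * v j` is that of the recursive definitions of the polynomials below, hence
-- their factors `1ℤ`. With `h = hankel a` and `u` the coefficients of p, entry i of a combination
-- is the functional with moments `a` applied to x^i p.
combination-linear : ∀ n u α v h i →
  combination n (λ j → u j + α * v j) h i ≡ combination n u h i + α * combination n v h i
combination-linear zero u α v h i = lem α
  where
  lem : ∀ α → 0ℤ ≡ 0ℤ + α * 0ℤ
  lem = solve-∀
combination-linear (suc n) u α v h i rewrite combination-linear n u α v h i = lem α (combination n u h i) (combination n v h i) (u n) (v n) (h n i)
  where
  lem : ∀ α x y u v h → x + α * y + (u + α * v) * h ≡ x + u * h + α * (y + v * h)
  lem = solve-∀

combination-pad : ∀ n u h i → u n ≡ 0ℤ → combination (suc n) u h i ≡ combination n u h i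
combination-pad n u h i un≡0 rewrite un≡0 = ℤ.+-identityʳ (combination n u h i)

repeated-column : Alternating f → ∀ h {j n} → j < n → f (applyUpTo h n ++ h j ∷ []) ≡ 0ℤ
repeated-column A h {zero}  {suc n} _         = repeat-last A (h 0) (applyUpTo (h ∘ suc) n)
repeated-column A h {suc j} {suc n} (s<s j<n) = repeated-column (prepend (h 0) A) (h ∘ suc) j<n

dependent-column : Alternating f → ∀ u h {m n} → m ≤ n → f (applyUpTo h n ++ combination m u h ∷ []) ≡ 0ℤ
-- The zero column is 0 times an arbitrary column; `h 0` is only a placeholder.
dependent-column A u h {zero}  {n} _   = A .linear (applyUpTo h n) {u = h 0} {h 0} 0ℤ 0ℤ [] λ _ → refl
dependent-column {f} A u h {suc m} {n} m<n = begin
  f (hs ++ combination (suc m) u h ∷ [])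
    ≡⟨ A .linear hs 1ℤ (u m) [] (λ i → cong (_+ u m * h m i) (sym (ℤ.*-identityˡ (combination m u h i)))) ⟩
  1ℤ * f (hs ++ combination m u h ∷ []) + u m * f (hs ++ h m ∷ [])
    ≡⟨ cong₂ (λ x y → 1ℤ * x + u m * y) (dependent-column A u h (ℕ.<⇒≤ m<n)) (repeated-column A h m<n) ⟩
  1ℤ * 0ℤ + u m * 0ℤ
    ≡⟨ lem (u m) ⟩
  0ℤ ∎
  where
  hs = applyUpTo h n
  lem : ∀ x → 1ℤ * 0ℤ + x * 0ℤ ≡ 0ℤ
  lem = solve-∀

-- Only the top term contributes; all others repeat a column already present.
combination-column : Alternating f → ∀ n u h →
  f (applyUpTo h n ++ combination (suc n) u h ∷ []) ≡ u n * f (applyUpTo h (suc n))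
combination-column {f} A n u h = begin
  f (hs ++ combination (suc n) u h ∷ [])
    ≡⟨ A .linear hs 1ℤ (u n) [] (λ i → cong (_+ u n * h n i) (sym (ℤ.*-identityˡ (combination n u h i)))) ⟩
  1ℤ * f (hs ++ combination n u h ∷ []) + u n * f (hs ++ h n ∷ [])
    ≡⟨ cong₂ (λ x y → 1ℤ * x + u n * f y) (dependent-column A u h ℕ.≤-refl) (applyUpTo-∷ʳ h n) ⟩
  1ℤ * 0ℤ + u n * f (applyUpTo h (suc n))
    ≡⟨ ℤ.+-identityˡ (u n * f (applyUpTo h (suc n))) ⟩
  u n * f (applyUpTo h (suc n)) ∎
  where
  hs = applyUpTo h n

-- If u lists the coefficients of a polynomial q and h those of a Hankel matrix, the
-- hypothesis says that q is orthogonal to all polynomials of degree less than n.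
D-step : ∀ n u h → (∀ i → i < n → combination (suc n) u h i ≡ 0ℤ) →
  u n * D (suc n) (applyUpTo h (suc n)) ≡ combination (suc n) u h n * D n (applyUpTo h n)
D-step n u h orthogonal = trans
  (sym (combination-column (D-alternating (suc n)) n u h))
  (D-last n (applyUpTo h n) orthogonal)

-- On the rows that count, the relation among the columns makes `u (suc n)` times the last column
-- equal to `- u 0` times `h 0`, up to the columns in between. Moving `h 0` to the front past n
-- columns gives the rest of the sign.
D-shift : ∀ n u h → (∀ i → i < suc n → combination (suc (suc n)) u h i ≡ 0ℤ) →
  u (suc n) * D (suc n) (applyUpTo (h ∘ suc) (suc n)) ≡
  -1ℤ ^ suc n * (u 0 * D (suc n) (applyUpTo h (suc n)))
D-shift n u h orthogonal = begin
  u (suc n) * D′ (applyUpTo (h ∘ suc) (suc n))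
    ≡⟨ combination-column A n (u ∘ suc) (h ∘ suc) ⟨
  D′ (hs ++ t ∷ [])
    -- The `h 0` term is added and subtracted so that the full relation, which has determinant 0,
    -- can be recognised.
    ≡⟨ isolate (u 0) (D′ (hs ++ h 0 ∷ [])) _ ⟩
  u 0 * D′ (hs ++ h 0 ∷ []) + 1ℤ * D′ (hs ++ t ∷ []) - u 0 * D′ (hs ++ h 0 ∷ [])
    ≡⟨ cong₂ (λ x y → x - u 0 * y) (trans (sym split) (D-last-zero (suc n) hs orthogonal)) rotated ⟩
  0ℤ - u 0 * (-1ℤ ^ n * D′ (h 0 ∷ hs))
    ≡⟨ lem (u 0) (-1ℤ ^ n) (D′ (h 0 ∷ hs)) ⟩
  -1ℤ ^ suc n * (u 0 * D′ (h 0 ∷ hs)) ∎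
  where
  A = D-alternating (suc n)
  D′ = D (suc n)
  hs = applyUpTo (h ∘ suc) n
  t  = combination (suc n) (u ∘ suc) (h ∘ suc)
  split : D′ (hs ++ combination (suc (suc n)) u h ∷ []) ≡ u 0 * D′ (hs ++ h 0 ∷ []) + 1ℤ * D′ (hs ++ t ∷ [])
  split = A .linear hs (u 0) 1ℤ [] λ i →
    trans (combination-uncons (suc n) u h i) (cong (λ x → u 0 * h 0 i + x) (sym (ℤ.*-identityˡ _)))
  rotated : D′ (hs ++ h 0 ∷ []) ≡ -1ℤ ^ n * D′ (h 0 ∷ hs)
  rotated = trans (rotate A (h 0) hs [])
    (cong₂ (λ k cs → -1ℤ ^ k * D′ (h 0 ∷ cs)) (length-applyUpTo (h ∘ suc) n) (++-identityʳ hs))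
  isolate : ∀ u x y → y ≡ u * x + 1ℤ * y - u * x
  isolate = solve-∀
  lem : ∀ u s x → 0ℤ - u * (s * x) ≡ -1ℤ * s * (u * x)
  lem = solve-∀

-- Hankel matrices

hankel : (ℕ → ℤ) → ℕ → Column
hankel a j i = a (i ℕ.+ j)

tabulate≡applyUpTo : ∀ (h : ℕ → Column) n → tabulate {n = n} (h ∘ toℕ) ≡ applyUpTo h n
tabulate≡applyUpTo h zero    = refl
tabulate≡applyUpTo h (suc n) = cong (h 0 ∷_) (tabulate≡applyUpTo (h ∘ suc) n)

D̄₀≡D : ∀ n → D̄₀ n ≡ D n (applyUpTo (hankel b̄) n)
D̄₀≡D n = trans (det≡D n (hankel b̄ ∘ toℕ)) (cong (D n) (tabulate≡applyUpTo (hankel b̄) n))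

-- The shift is moved onto the column index: the matrix becomes the unshifted one without its first
-- column, as `D-shift` requires.
D̄₁≡D : ∀ n → D̄₁ n ≡ D n (applyUpTo (hankel b̄ ∘ suc) n)
D̄₁≡D n = begin
  D̄₁ n                                ≡⟨ det≡D n (h ∘ toℕ) ⟩
  D n (tabulate (h ∘ toℕ))            ≡⟨ cong (D n) (tabulate≡applyUpTo h n) ⟩
  D n (applyUpTo h n)                 ≡⟨ applyUpTo-cong (D-alternating n) n (λ j i → cong b̄ (index i j)) ⟩
  D n (applyUpTo (hankel b̄ ∘ suc) n) ∎
  where
  h : ℕ → Column
  h j i = b̄ (i ℕ.+ j ℕ.+ 1)
  index : ∀ i j → i ℕ.+ j ℕ.+ 1 ≡ i ℕ.+ suc j
  index i j = trans (ℕ.+-comm (i ℕ.+ j) 1) (sym (ℕ.+-suc i j))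

-- Multiplication of a polynomial by its variable, on coefficients.
shift : (ℕ → ℤ) → ℕ → ℤ
shift u zero    = 0ℤ
shift u (suc j) = u j

combination-hankel-suc : ∀ n u a i → combination n u (hankel a ∘ suc) i ≡ combination n u (hankel a) (suc i)
combination-hankel-suc zero    u a i = refl
combination-hankel-suc (suc n) u a i =
  cong₂ (λ x k → x + u n * a k) (combination-hankel-suc n u a i) (ℕ.+-suc i n)

combination-shift : ∀ n u a i →
  combination (suc n) (shift u) (hankel a) i ≡ combination n u (hankel a) (suc i)
combination-shift n u a i = trans (combination-uncons n (shift u) (hankel a) i)
  (trans (ℤ.+-identityˡ _) (combination-hankel-suc n u a i))

-- Interleaving with zeros: the substitution x = y²

private
  I = interleaveZeros

interleave-even : ∀ a n → I a (n ℕ.* 2) ≡ a n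
interleave-even a zero    = refl
interleave-even a (suc n) = interleave-even (a ∘ suc) n

interleave-odd : ∀ a n → I a (suc (n ℕ.* 2)) ≡ 0ℤ
interleave-odd a zero    = refl
interleave-odd a (suc n) = interleave-odd (a ∘ suc) n

interleave-shift : ∀ a m i → I a (i ℕ.+ m ℕ.* 2) ≡ I (hankel a m) i
interleave-shift a m zero          = interleave-even a m
interleave-shift a m (suc zero)    = interleave-odd a m
interleave-shift a m (suc (suc i)) = interleave-shift (a ∘ suc) m i

interleave-linear : ∀ s α t i → I (λ k → s k + α * t k) i ≡ I s i + α * I t i
interleave-linear s α t zero          = refl
interleave-linear s α t (suc zero)    = sym (trans (ℤ.+-identityˡ _) (ℤ.*-zeroʳ α))
interleave-linear s α t (suc (suc i)) = interleave-linear (s ∘ suc) α (t ∘ suc) i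

interleave-zero : ∀ {s} m → (∀ i → i < m → s i ≡ 0ℤ) → ∀ i → i < m ℕ.* 2 → I s i ≡ 0ℤ
interleave-zero (suc m) s≡0 zero          _               = s≡0 0 z<s
interleave-zero (suc m) s≡0 (suc zero)    _               = refl
interleave-zero (suc m) s≡0 (suc (suc i)) (s<s (s<s i<)) = interleave-zero m (λ k k<m → s≡0 (suc k) (s<s k<m)) i i<

-- If `u` is p(x), then `I u` is p(y²). The functional with moments `I a` kills odd powers of y and
-- agrees on y² with that of `a`.
interleave-combination : ∀ m u a i →
  combination (suc (m ℕ.* 2)) (I u) (hankel (I a)) i ≡ I (combination (suc m) u (hankel a)) i
interleave-combination zero u a i = begin
  0ℤ + u 0 * I a (i ℕ.+ 0)                 ≡⟨ cong₂ (λ x y → x + u 0 * y) (zeros i) (interleave-shift a 0 i) ⟩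
  I (λ _ → 0ℤ) i + u 0 * I (hankel a 0) i  ≡⟨ interleave-linear (λ _ → 0ℤ) (u 0) (hankel a 0) i ⟨
  I (combination 1 u (hankel a)) i         ∎
  where
  zeros : ∀ i → 0ℤ ≡ I (λ _ → 0ℤ) i
  zeros zero          = refl
  zeros (suc zero)    = refl
  zeros (suc (suc i)) = zeros i
interleave-combination (suc m) u a i = begin
  combination (suc (m ℕ.* 2)) (I u) (hankel (I a)) i + I u (suc (m ℕ.* 2)) * _ + I u (suc m ℕ.* 2) * I a (i ℕ.+ suc m ℕ.* 2)
    ≡⟨ cong₂ _+_ (trans (combination-pad (suc (m ℕ.* 2)) (I u) (hankel (I a)) i (interleave-odd u m)) (interleave-combination m u a i))
         (cong₂ _*_ (interleave-even u (suc m)) (interleave-shift a (suc m) i)) ⟩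
  I (combination (suc m) u (hankel a)) i + u (suc m) * I (hankel a (suc m)) i
    ≡⟨ interleave-linear (combination (suc m) u (hankel a)) (u (suc m)) (hankel a (suc m)) i ⟨
  I (combination (suc (suc m)) u (hankel a)) i ∎

-- Moments and Lucas polynomials

-- e k i is the coefficient of t^(-k) in (t - 1/t)^i; the recursion for k = 0 uses the
-- symmetry of (t - 1/t)^i under t ↦ -1/t.
e : ℕ → ℕ → ℤ
e zero    zero    = 1ℤ
e (suc k) zero    = 0ℤ
e zero    (suc i) = + 2 * e 1 i
e (suc k) (suc i) = e (suc (suc k)) i - e k i

e-zero : ∀ {k i} → i < k → e k i ≡ 0ℤ
e-zero {suc k} {zero}  _         = refl
e-zero {suc k} {suc i} (s<s i<k) = cong₂ _-_ (e-zero (ℕ.m<n⇒m<1+n (ℕ.m<n⇒m<1+n i<k))) (e-zero i<k)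

e-diagonal : ∀ k → e k k ≡ -1ℤ ^ k
e-diagonal zero    = refl
e-diagonal (suc k) = begin
  e (suc (suc k)) k - e k k  ≡⟨ cong₂ _-_ (e-zero (ℕ.m<n⇒m<1+n (ℕ.n<1+n k))) (e-diagonal k) ⟩
  0ℤ - -1ℤ ^ k               ≡⟨ lem (-1ℤ ^ k) ⟩
  -1ℤ ^ suc k                ∎
  where
  lem : ∀ x → 0ℤ - x ≡ -1ℤ * x
  lem = solve-∀

-- All powers of t in (t - 1/t)^i have the parity of i.
e-odd : ∀ i k r → k ℕ.+ i ≡ suc (r ℕ.* 2) → e k i ≡ 0ℤ
e-odd zero    (suc k) r       eq = refl
e-odd (suc i) zero    r       eq = cong (+ 2 *_) (e-odd i 1 r eq)
e-odd (suc i) (suc k) zero    eq with () ← ℕ.1+n≢0 (trans (sym (ℕ.+-suc k i)) (ℕ.suc-injective eq))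
e-odd (suc i) (suc k) (suc r) eq = cong₂ _-_ (e-odd i (suc (suc k)) (suc r) (cong (2 ℕ.+_) eq′)) (e-odd i k r eq′)
  where
  eq′ : k ℕ.+ i ≡ suc (r ℕ.* 2)
  eq′ = ℕ.suc-injective (trans (sym (ℕ.+-suc k i)) (ℕ.suc-injective eq))

-- The recursion of `e` is a signed Pascal rule. For k = 0 the doubled term stands for the two equal
-- middle entries of an odd row.
e-binomial : ∀ i k r → i ≡ k ℕ.+ r ℕ.* 2 → e k i ≡ -1ℤ ^ (k ℕ.+ r) * + (i C r)
e-binomial zero    zero    zero    eq = refl
e-binomial (suc i) zero    (suc r) eq = begin
  + 2 * e 1 i                                            ≡⟨ cong (+ 2 *_) (e-binomial i 1 r i≡) ⟩
  + 2 * (-1ℤ ^ suc r * + (i C r))                        ≡⟨ lem (-1ℤ ^ suc r) (+ (i C r)) ⟩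
  -1ℤ ^ suc r * (+ (i C r) + + (i C r))                  ≡⟨ cong (λ x → -1ℤ ^ suc r * (+ (i C r) + + x)) symmetric ⟩
  -1ℤ ^ suc r * + (i C r ℕ.+ i C suc r)                  ≡⟨ cong (λ x → -1ℤ ^ suc r * + x) (nCk+nC[k+1]≡[n+1]C[k+1] i r) ⟩
  -1ℤ ^ suc r * + (suc i C suc r)                        ∎
  where
  i≡ : i ≡ suc (r ℕ.* 2)
  i≡ = ℕ.suc-injective eq
  i≡′ : i ≡ r ℕ.+ suc r
  i≡′ = trans i≡ (trans (cong suc (trans (ℕ.*-comm r 2) (cong (r ℕ.+_) (ℕ.+-identityʳ r)))) (sym (ℕ.+-suc r r)))
  symmetric : i C r ≡ i C suc r
  symmetric rewrite i≡′ = trans (nCk≡nC[n∸k] (ℕ.m≤m+n r (suc r))) (cong ((r ℕ.+ suc r) C_) (ℕ.m+n∸m≡n r (suc r)))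
  lem : ∀ s x → + 2 * (s * x) ≡ s * (x + x)
  lem = solve-∀
e-binomial (suc i) (suc k) zero    eq = begin
  e (suc (suc k)) i - e k i                  ≡⟨ cong₂ _-_ (e-zero i<) (e-binomial i k 0 (ℕ.suc-injective eq)) ⟩
  0ℤ - -1ℤ ^ (k ℕ.+ 0) * + 1                 ≡⟨ lem (-1ℤ ^ (k ℕ.+ 0)) ⟩
  -1ℤ ^ (suc k ℕ.+ 0) * + 1                  ∎
  where
  i< : i < suc (suc k)
  i< = ℕ.m≤n⇒m≤1+n (ℕ.≤-reflexive (trans eq (ℕ.+-identityʳ (suc k))))
  lem : ∀ s → 0ℤ - s * + 1 ≡ -1ℤ * s * + 1
  lem = solve-∀
e-binomial (suc i) (suc k) (suc r) eq
  rewrite e-binomial i (suc (suc k)) r (trans (ℕ.suc-injective eq) (trans (ℕ.+-suc k _) (cong suc (ℕ.+-suc k _))))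
        | e-binomial i k (suc r) (ℕ.suc-injective eq) | ℕ.+-suc k r | sym (nCk+nC[k+1]≡[n+1]C[k+1] i r)
        | ℤ.pos-+ (i C r) (i C suc r)
  = lem (-1ℤ ^ (k ℕ.+ r)) (+ (i C r)) (+ (i C suc r))
  where
  lem : ∀ s x y → -1ℤ * (-1ℤ * s) * x - -1ℤ * s * y ≡ -1ℤ * (-1ℤ * s) * (x + y)
  lem = solve-∀

-- Doubling is written `r * 2` because `suc r * 2` computes to two successors of `r * 2`.
data Halved : ℕ → Set where
  even : ∀ r → Halved (r ℕ.* 2)
  odd  : ∀ r → Halved (suc (r ℕ.* 2))

halve : ∀ n → Halved n
halve zero    = even 0
halve (suc n) with halve n
... | even r = odd r
... | odd  r = even (suc r)

⌈r*2/2⌉≡r : ∀ r → ⌈ r ℕ.* 2 /2⌉ ≡ r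
⌈r*2/2⌉≡r zero    = refl
⌈r*2/2⌉≡r (suc r) = cong suc (⌈r*2/2⌉≡r r)

⌈1+r*2/2⌉≡1+r : ∀ r → ⌈ suc (r ℕ.* 2) /2⌉ ≡ suc r
⌈1+r*2/2⌉≡1+r zero    = refl
⌈1+r*2/2⌉≡1+r (suc r) = cong suc (⌈1+r*2/2⌉≡1+r r)

e-central : ∀ r → e 0 (r ℕ.* 2) ≡ -1ℤ ^ r * + ((2 ℕ.* r) C r)
e-central r = trans (e-binomial (r ℕ.* 2) 0 r refl) (cong (λ n → -1ℤ ^ r * + (n C r)) (ℕ.*-comm r 2))

-- One of n and n + 1 is odd and contributes 0; the even one gives the central binomial coefficient
-- shared by both indices of a pair.
b≡e+e : ∀ n → b n ≡ e 0 n + e 0 (suc n)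
b≡e+e n with halve n
... | even zero    = refl
... | even (suc r) = begin
  b (suc r ℕ.* 2)                               ≡⟨ cong (λ m → -1ℤ ^ m * + ((2 ℕ.* m) C m)) (⌈r*2/2⌉≡r (suc r)) ⟩
  -1ℤ ^ suc r * + ((2 ℕ.* suc r) C suc r)       ≡⟨ e-central (suc r) ⟨
  e 0 (suc r ℕ.* 2)                             ≡⟨ ℤ.+-identityʳ (e 0 (suc r ℕ.* 2)) ⟨
  e 0 (suc r ℕ.* 2) + 0ℤ                        ≡⟨ cong (λ x → e 0 (suc r ℕ.* 2) + x) (e-odd (suc (suc r ℕ.* 2)) 0 (suc r) refl) ⟨
  e 0 (suc r ℕ.* 2) + e 0 (suc (suc r ℕ.* 2))   ∎
... | odd r = begin
  b (suc (r ℕ.* 2))                             ≡⟨ cong (λ m → -1ℤ ^ m * + ((2 ℕ.* m) C m)) (⌈1+r*2/2⌉≡1+r r) ⟩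
  -1ℤ ^ suc r * + ((2 ℕ.* suc r) C suc r)       ≡⟨ e-central (suc r) ⟨
  e 0 (suc r ℕ.* 2)                             ≡⟨ ℤ.+-identityˡ (e 0 (suc r ℕ.* 2)) ⟨
  0ℤ + e 0 (suc r ℕ.* 2)                        ≡⟨ cong (_+ e 0 (suc r ℕ.* 2)) (e-odd (suc (r ℕ.* 2)) 0 r refl) ⟨
  e 0 (suc (r ℕ.* 2)) + e 0 (suc r ℕ.* 2)       ∎

0<L : ∀ n → 0ℤ ℤ.< L n
0<L 0             = +<+ z<s
0<L 1             = +<+ z<s
0<L (suc (suc n)) = ℤ.+-mono-< (0<L (suc n)) (0<L n)

-- To keep integer coefficients, the orthogonal polynomials below may have a Lucas number as leading
-- coefficient; this removes it from the determinant identities.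
L-cancel : ∀ n {i j} → L n * i ≡ L n * j → i ≡ j
L-cancel n {i} {j} = ℤ.*-cancelˡ-≡ (L n) i j {{>-nonZero (0<L n)}}

-1^even : ∀ n → -1ℤ ^ (n ℕ.* 2) ≡ 1ℤ
-1^even zero    = refl
-1^even (suc n) rewrite -1^even n = refl

bCombination : ℕ → (ℕ → ℤ) → Column
bCombination n u = combination n u (hankel b)

one : ℕ → ℤ
one zero    = 1ℤ
one (suc _) = 0ℤ

-- Coefficients of the Lucas polynomials, given by l_k (t - 1/t) = t^k + (-1/t)^k.
lucas : ℕ → ℕ → ℤ
lucas 0             j = + 2 * one j
lucas 1             j = shift one j
lucas (suc (suc k)) j = shift (lucas (suc k)) j + 1ℤ * lucas k j

lucas-degree : ∀ {k j} → k < j → lucas k j ≡ 0ℤ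
lucas-degree {0}           {suc j}       _         = refl
lucas-degree {1}           {suc zero}    (s<s ())
lucas-degree {1}           {suc (suc j)} _         = refl
lucas-degree {suc (suc k)} {suc j}       (s<s k<j) =
  cong₂ (λ x y → x + 1ℤ * y) (lucas-degree k<j) (lucas-degree (ℕ.<-trans (ℕ.n<1+n k) (ℕ.m<n⇒m<1+n k<j)))

lucas-leading : ∀ k → lucas (suc k) (suc k) ≡ 1ℤ
lucas-leading zero    = refl
lucas-leading (suc k) =
  cong₂ (λ x y → x + 1ℤ * y) (lucas-leading k) (lucas-degree (ℕ.m<n⇒m<1+n (ℕ.n<1+n k)))

-- By the symmetry t ↦ -1/t, both terms of l_k contribute `e k i` to the constant term of x^i l_k;
-- the weight 1 + x adds the same with i + 1. The induction matches the recurrences of l_k and `e`.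
lucas-combination : ∀ k i → bCombination (suc k) (lucas k) i ≡ + 2 * (e k i + e k (suc i))
lucas-combination 0 i rewrite ℕ.+-identityʳ i | b≡e+e i = ℤ.+-identityˡ _
lucas-combination 1 i rewrite ℕ.+-comm i 1 | b≡e+e (suc i) = lem (b i) (e 1 i) (e 1 (suc i))
  where
  lem : ∀ b x y → 0ℤ + 0ℤ * b + 1ℤ * (+ 2 * x + + 2 * y) ≡ + 2 * (x + y)
  lem = solve-∀
lucas-combination (suc (suc k)) i = begin
  bCombination n (lucas (suc (suc k))) i
    ≡⟨ combination-linear n (shift (lucas (suc k))) 1ℤ (lucas k) (hankel b) i ⟩
  bCombination n (shift (lucas (suc k))) i + 1ℤ * bCombination n (lucas k) i
    ≡⟨ cong₂ (λ x y → x + 1ℤ * y)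
         (trans (combination-shift (suc (suc k)) (lucas (suc k)) b i) (lucas-combination (suc k) (suc i)))
         (trans (combination-pad (suc (suc k)) (lucas k) (hankel b) i (lucas-degree (ℕ.m<n⇒m<1+n (ℕ.n<1+n k))))
           (trans (combination-pad (suc k) (lucas k) (hankel b) i (lucas-degree (ℕ.n<1+n k))) (lucas-combination k i))) ⟩
  + 2 * (e (suc k) (suc i) + e (suc k) (suc (suc i))) + 1ℤ * (+ 2 * (e k i + e k (suc i)))
    ≡⟨ lem (e (suc (suc k)) i) (e k i) (e (suc (suc k)) (suc i)) (e k (suc i)) ⟩
  + 2 * (e (suc (suc k)) i + e (suc (suc k)) (suc i)) ∎
  where
  n = suc (suc (suc k))
  lem : ∀ x y z w → + 2 * ((x - y) + (z - w)) + 1ℤ * (+ 2 * (y + w)) ≡ + 2 * (x + z)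
  lem = solve-∀

-- (1 + x) kernel m = L_m l_{m+1} + L_{m+1} l_m.
kernel : ℕ → ℕ → ℤ
kernel zero    j = lucas 0 j
kernel (suc m) j = kernel m j + L (suc m) * lucas (suc m) j

kernel-degree : ∀ {m j} → m < j → kernel m j ≡ 0ℤ
kernel-degree {zero}  {suc j} m<j = refl
kernel-degree {suc m} {j}     m<j
  rewrite kernel-degree (ℕ.<-trans (ℕ.n<1+n m) m<j) | lucas-degree m<j | ℤ.*-zeroʳ (L (suc m)) = refl

kernel-leading : ∀ m → kernel m m ≡ L m
kernel-leading zero    = refl
kernel-leading (suc m) rewrite kernel-degree (ℕ.n<1+n m) | lucas-leading m =
  trans (ℤ.+-identityˡ _) (ℤ.*-identityʳ (L (suc m)))

-- The weight supplies the factor 1 + x that turns the kernel into two Lucas polynomials. The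
-- induction is this telescoping, with `e (suc m) (suc i)` and `L (suc (suc m))` unfolded.
kernel-combination : ∀ m i →
  bCombination (suc m) (kernel m) i ≡ + 2 * (L m * e (suc m) i + L (suc m) * e m i)
kernel-combination zero i = trans (lucas-combination 0 i) (lem (e 0 i) (e 1 i))
  where
  lem : ∀ x y → + 2 * (x + + 2 * y) ≡ + 2 * (+ 2 * y + + 1 * x)
  lem = solve-∀
kernel-combination (suc m) i = begin
  bCombination (suc (suc m)) (kernel (suc m)) i
    ≡⟨ combination-linear (suc (suc m)) (kernel m) (L (suc m)) (lucas (suc m)) (hankel b) i ⟩
  bCombination (suc (suc m)) (kernel m) i + L (suc m) * bCombination (suc (suc m)) (lucas (suc m)) i
    ≡⟨ cong₂ (λ x y → x + L (suc m) * y)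
         (trans (combination-pad (suc m) (kernel m) (hankel b) i (kernel-degree (ℕ.n<1+n m))) (kernel-combination m i))
         (lucas-combination (suc m) i) ⟩
  + 2 * (L m * e (suc m) i + L (suc m) * e m i) + L (suc m) * (+ 2 * (e (suc m) i + e (suc m) (suc i)))
    ≡⟨ lem (L m) (L (suc m)) (e (suc m) i) (e m i) (e (suc (suc m)) i) ⟩
  + 2 * (L (suc m) * e (suc (suc m)) i + L (suc (suc m)) * e (suc m) i) ∎
  where
  lem : ∀ p q x y z → + 2 * (p * x + q * y) + q * (+ 2 * (x + (z - y))) ≡ + 2 * (q * z + (q + p) * x)
  lem = solve-∀

-- At t = 1, x is 0 and l_k is 1 + (-1)^k.
lucas-constant-odd : ∀ n → lucas (suc (n ℕ.* 2)) 0 ≡ 0ℤ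
lucas-constant-odd zero    = refl
lucas-constant-odd (suc n) rewrite lucas-constant-odd n = refl

lucas-constant-even : ∀ n → lucas (n ℕ.* 2) 0 ≡ + 2
lucas-constant-even zero    = refl
lucas-constant-even (suc n) rewrite lucas-constant-even n = refl

-- At x = 0 only the Lucas polynomial of even index survives in the two-term form; its factor is the
-- `L` of odd index, the same in both cases.
kernel-constant-even : ∀ n → kernel (n ℕ.* 2) 0 ≡ + 2 * L (suc (n ℕ.* 2))
kernel-constant-odd  : ∀ n → kernel (suc (n ℕ.* 2)) 0 ≡ + 2 * L (suc (n ℕ.* 2))
kernel-constant-even zero    = refl
kernel-constant-even (suc n) rewrite kernel-constant-odd n | lucas-constant-even n =
  lem (L (suc (n ℕ.* 2))) (L (n ℕ.* 2))
  where
  lem : ∀ x y → + 2 * x + (x + y) * + 2 ≡ + 2 * (x + y + x)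
  lem = solve-∀
kernel-constant-odd n rewrite kernel-constant-even n | lucas-constant-odd n | ℤ.*-zeroʳ (L (suc (n ℕ.* 2))) =
  ℤ.+-identityʳ _

-- x (evenKernel n) = l_{2n+1}.
evenKernel : ℕ → ℕ → ℤ
evenKernel zero    j = one j
evenKernel (suc n) j = evenKernel n j + 1ℤ * lucas (suc n ℕ.* 2) j

evenKernel-degree : ∀ n {j} → n ℕ.* 2 < j → evenKernel n j ≡ 0ℤ
evenKernel-degree zero    {suc j} _ = refl
evenKernel-degree (suc n) n<j
  rewrite evenKernel-degree n (ℕ.<-trans (ℕ.n<1+n _) (ℕ.<-trans (ℕ.n<1+n _) n<j)) | lucas-degree n<j = refl

evenKernel-leading : ∀ n → evenKernel n (n ℕ.* 2) ≡ 1ℤ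
evenKernel-leading zero    = refl
evenKernel-leading (suc n)
  rewrite evenKernel-degree n (ℕ.<-trans (ℕ.n<1+n (n ℕ.* 2)) (ℕ.n<1+n _)) | lucas-leading (suc (n ℕ.* 2)) = refl

-- The row `suc i` supplies the extra factor x of the weight x (1 + x), which completes the
-- polynomial to l_{2n+1}.
evenKernel-combination : ∀ n i → bCombination (suc (n ℕ.* 2)) (evenKernel n) (suc i) ≡
  + 2 * (e (suc (n ℕ.* 2)) i + e (suc (n ℕ.* 2)) (suc i))
evenKernel-combination zero i rewrite ℕ.+-identityʳ i | b≡e+e (suc i) = lem (e 1 i) (e 1 (suc i))
  where
  lem : ∀ x y → 0ℤ + 1ℤ * (+ 2 * x + + 2 * y) ≡ + 2 * (x + y)
  lem = solve-∀
evenKernel-combination (suc n) i = begin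
  bCombination (suc (suc (suc k))) (evenKernel (suc n)) (suc i)
    ≡⟨ combination-linear (suc (suc (suc k))) (evenKernel n) 1ℤ (lucas (suc (suc k))) (hankel b) (suc i) ⟩
  bCombination (suc (suc (suc k))) (evenKernel n) (suc i) + 1ℤ * bCombination (suc (suc (suc k))) (lucas (suc (suc k))) (suc i)
    ≡⟨ cong₂ (λ x y → x + 1ℤ * y)
         (trans (combination-pad (suc (suc k)) (evenKernel n) (hankel b) (suc i) (evenKernel-degree n (ℕ.m<n⇒m<1+n (ℕ.n<1+n k))))
           (trans (combination-pad (suc k) (evenKernel n) (hankel b) (suc i) (evenKernel-degree n (ℕ.n<1+n k)))
             (evenKernel-combination n i)))
         (lucas-combination (suc (suc k)) (suc i)) ⟩
  + 2 * (e (suc k) i + e (suc k) (suc i)) + 1ℤ * (+ 2 * (e (suc (suc k)) (suc i) + e (suc (suc k)) (suc (suc i))))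
    ≡⟨ lem (e (suc k) i) (e (suc k) (suc i)) (e (suc (suc (suc k))) i) (e (suc (suc (suc k))) (suc i)) ⟩
  + 2 * (e (suc (suc (suc k))) i + e (suc (suc (suc k))) (suc i)) ∎
  where
  k = n ℕ.* 2
  lem : ∀ x y z w → + 2 * (x + y) + 1ℤ * (+ 2 * ((z - x) + (w - y))) ≡ + 2 * (z + w)
  lem = solve-∀

-- x (1 + x) (oddKernel n) = L_m l_{m+2} - L_{m+2} l_m with m = 2n + 1.
oddKernel : ℕ → ℕ → ℤ
oddKernel n j = kernel (suc (n ℕ.* 2)) j + (- L (suc n ℕ.* 2)) * evenKernel n j

oddKernel-leading : ∀ n → oddKernel n (suc (n ℕ.* 2)) ≡ L (suc (n ℕ.* 2))
oddKernel-leading n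
  rewrite kernel-leading (suc (n ℕ.* 2)) | evenKernel-degree n (ℕ.n<1+n (n ℕ.* 2)) | ℤ.*-zeroʳ (- L (suc n ℕ.* 2)) =
  ℤ.+-identityʳ _

-- With m = 2n + 1, the term in `e m (suc i)` is what prevents `kernel m` from being orthogonal for
-- x (1 + x), at i = m - 1. The multiple of `evenKernel n` is chosen to cancel it.
oddKernel-combination : ∀ n i → bCombination (suc (suc (n ℕ.* 2))) (oddKernel n) (suc i) ≡
  + 2 * (L (suc (n ℕ.* 2)) * e (suc n ℕ.* 2) (suc i) - L (suc n ℕ.* 2) * e (suc (n ℕ.* 2)) i)
oddKernel-combination n i = begin
  bCombination (suc m) (oddKernel n) (suc i)
    ≡⟨ combination-linear (suc m) (kernel m) (- L (suc m)) (evenKernel n) (hankel b) (suc i) ⟩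
  bCombination (suc m) (kernel m) (suc i) + (- L (suc m)) * bCombination (suc m) (evenKernel n) (suc i)
    ≡⟨ cong₂ (λ x y → x + (- L (suc m)) * y) (kernel-combination m (suc i))
         (trans (combination-pad m (evenKernel n) (hankel b) (suc i) (evenKernel-degree n (ℕ.n<1+n _)))
           (evenKernel-combination n i)) ⟩
  + 2 * (L m * e (suc m) (suc i) + L (suc m) * e m (suc i)) + (- L (suc m)) * (+ 2 * (e m i + e m (suc i)))
    ≡⟨ lem (L m) (L (suc m)) (e (suc m) (suc i)) (e m i) (e m (suc i)) ⟩
  + 2 * (L m * e (suc m) (suc i) - L (suc m) * e m i) ∎
  where
  m = suc (n ℕ.* 2)
  lem : ∀ p q x y z → + 2 * (p * x + q * z) + (- q) * (+ 2 * (y + z)) ≡ + 2 * (p * x - q * y)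
  lem = solve-∀

-- Determinant ratios

-- Here q_{2m}(y) is a multiple of u(y²), and m orthogonality relations yield 2m because the odd
-- rows vanish by parity.
even-step : ∀ m u → (∀ i → i < m → bCombination (suc m) u i ≡ 0ℤ) →
  u m * D̄₀ (suc (m ℕ.* 2)) ≡ bCombination (suc m) u m * D̄₀ (m ℕ.* 2)
even-step m u orthogonal = begin
  u m * D̄₀ (suc (m ℕ.* 2))
    ≡⟨ cong₂ _*_ (sym (interleave-even u m)) (D̄₀≡D (suc (m ℕ.* 2))) ⟩
  I u (m ℕ.* 2) * D (suc (m ℕ.* 2)) (applyUpTo (hankel b̄) (suc (m ℕ.* 2)))
    ≡⟨ D-step (m ℕ.* 2) (I u) (hankel b̄) (λ i i< →
         trans (interleave-combination m u b i) (interleave-zero m orthogonal i i<)) ⟩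
  combination (suc (m ℕ.* 2)) (I u) (hankel b̄) (m ℕ.* 2) * D (m ℕ.* 2) (applyUpTo (hankel b̄) (m ℕ.* 2))
    ≡⟨ cong₂ _*_ (trans (interleave-combination m u b (m ℕ.* 2)) (interleave-even (bCombination (suc m) u) m))
         (sym (D̄₀≡D (m ℕ.* 2))) ⟩
  bCombination (suc m) u m * D̄₀ (m ℕ.* 2) ∎

even-shift : ∀ m u → (∀ i → i < suc m → bCombination (suc (suc m)) u i ≡ 0ℤ) →
  u (suc m) * D̄₁ (suc m ℕ.* 2) ≡ u 0 * D̄₀ (suc m ℕ.* 2)
even-shift m u orthogonal = begin
  u (suc m) * D̄₁ N
    ≡⟨ cong₂ _*_ (sym (interleave-even u (suc m))) (D̄₁≡D N) ⟩
  I u N * D N (applyUpTo (hankel b̄ ∘ suc) N)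
    ≡⟨ D-shift (suc (m ℕ.* 2)) (I u) (hankel b̄) (λ i i< →
         trans (interleave-combination (suc m) u b i) (interleave-zero (suc m) orthogonal i i<)) ⟩
  -1ℤ ^ N * (u 0 * D N (applyUpTo (hankel b̄) N))
    ≡⟨ cong₂ (λ s x → s * (u 0 * x)) (-1^even (suc m)) (sym (D̄₀≡D N)) ⟩
  1ℤ * (u 0 * D̄₀ N)
    ≡⟨ ℤ.*-identityˡ (u 0 * D̄₀ N) ⟩
  u 0 * D̄₀ N ∎
  where
  N = suc m ℕ.* 2

odd-combination : ∀ m u i →
  combination (suc (suc (m ℕ.* 2))) (shift (I u)) (hankel b̄) i ≡ I (bCombination (suc m) u) (suc i)
odd-combination m u i =
  trans (combination-shift (suc (m ℕ.* 2)) (I u) b̄ i) (interleave-combination m u b (suc i))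

-- The odd polynomial y u(y²) pairs to 0 with even powers of y by parity; with odd powers it yields
-- the functional of weight x (1 + x).
odd-orthogonal : ∀ m u → (∀ i → i < m → bCombination (suc m) u (suc i) ≡ 0ℤ) →
  ∀ i → i < suc (m ℕ.* 2) → combination (suc (suc (m ℕ.* 2))) (shift (I u)) (hankel b̄) i ≡ 0ℤ
odd-orthogonal m u orthogonal zero    _        = odd-combination m u 0
odd-orthogonal m u orthogonal (suc i) (s<s i<) =
  trans (odd-combination m u (suc i)) (interleave-zero m orthogonal i i<)

odd-step : ∀ m u → (∀ i → i < m → bCombination (suc m) u (suc i) ≡ 0ℤ) →
  u m * D̄₀ (suc m ℕ.* 2) ≡ bCombination (suc m) u (suc m) * D̄₀ (suc (m ℕ.* 2))
odd-step m u orthogonal = begin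
  u m * D̄₀ (suc N)
    ≡⟨ cong₂ _*_ (sym (interleave-even u m)) (D̄₀≡D (suc N)) ⟩
  I u (m ℕ.* 2) * D (suc N) (applyUpTo (hankel b̄) (suc N))
    ≡⟨ D-step N (shift (I u)) (hankel b̄) (odd-orthogonal m u orthogonal) ⟩
  combination (suc N) (shift (I u)) (hankel b̄) N * D N (applyUpTo (hankel b̄) N)
    ≡⟨ cong₂ _*_ (trans (odd-combination m u N) (interleave-even (bCombination (suc m) u) (suc m))) (sym (D̄₀≡D N)) ⟩
  bCombination (suc m) u (suc m) * D̄₀ N ∎
  where
  N = suc (m ℕ.* 2)

-- The constant coefficient of y u(y²) is 0.
odd-shift : ∀ m u → (∀ i → i < m → bCombination (suc m) u (suc i) ≡ 0ℤ) →
  u m * D̄₁ (suc (m ℕ.* 2)) ≡ 0ℤ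
odd-shift m u orthogonal = begin
  u m * D̄₁ N
    ≡⟨ cong₂ _*_ (sym (interleave-even u m)) (D̄₁≡D N) ⟩
  I u (m ℕ.* 2) * D N (applyUpTo (hankel b̄ ∘ suc) N)
    ≡⟨ D-shift (m ℕ.* 2) (shift (I u)) (hankel b̄) (odd-orthogonal m u orthogonal) ⟩
  -1ℤ ^ N * (0ℤ * D N (applyUpTo (hankel b̄) N))
    ≡⟨ ℤ.*-zeroʳ (-1ℤ ^ N) ⟩
  0ℤ ∎
  where
  N = suc (m ℕ.* 2)

kernel-orthogonal : ∀ m i → i < m → bCombination (suc m) (kernel m) i ≡ 0ℤ
kernel-orthogonal m i i<m
  rewrite kernel-combination m i | e-zero (ℕ.m<n⇒m<1+n i<m) | e-zero i<m = lem (L m) (L (suc m))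
  where
  lem : ∀ x y → + 2 * (x * 0ℤ + y * 0ℤ) ≡ 0ℤ
  lem = solve-∀

kernel-norm : ∀ m → bCombination (suc m) (kernel m) m ≡ + 2 * (L (suc m) * -1ℤ ^ m)
kernel-norm m rewrite kernel-combination m m | e-zero (ℕ.n<1+n m) | e-diagonal m = lem (L m) _
  where
  lem : ∀ x y → + 2 * (x * 0ℤ + y) ≡ + 2 * y
  lem = solve-∀

evenKernel-orthogonal : ∀ n i → i < n ℕ.* 2 → bCombination (suc (n ℕ.* 2)) (evenKernel n) (suc i) ≡ 0ℤ
evenKernel-orthogonal n i i<
  rewrite evenKernel-combination n i | e-zero (ℕ.m<n⇒m<1+n i<) | e-zero (s<s i<) = refl

evenKernel-norm : ∀ n → bCombination (suc (n ℕ.* 2)) (evenKernel n) (suc (n ℕ.* 2)) ≡ - + 2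
evenKernel-norm n
  rewrite evenKernel-combination n (n ℕ.* 2) | e-zero (ℕ.n<1+n (n ℕ.* 2)) | e-diagonal (suc (n ℕ.* 2)) | -1^even n = refl

oddKernel-orthogonal : ∀ n i → i < suc (n ℕ.* 2) → bCombination (suc (suc (n ℕ.* 2))) (oddKernel n) (suc i) ≡ 0ℤ
oddKernel-orthogonal n i i<
  rewrite oddKernel-combination n i | e-zero (s<s i<) | e-zero i< = lem (L (suc (n ℕ.* 2))) (L (suc n ℕ.* 2))
  where
  lem : ∀ x y → + 2 * (x * 0ℤ - y * 0ℤ) ≡ 0ℤ
  lem = solve-∀

oddKernel-norm : ∀ n →
  bCombination (suc (suc (n ℕ.* 2))) (oddKernel n) (suc (suc (n ℕ.* 2))) ≡ + 2 * L (suc (suc n ℕ.* 2))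
oddKernel-norm n
  rewrite oddKernel-combination n (suc (n ℕ.* 2)) | e-diagonal (suc n ℕ.* 2) | e-diagonal (suc (n ℕ.* 2)) | -1^even n
  = lem (L (suc (n ℕ.* 2))) (L (suc n ℕ.* 2))
  where
  lem : ∀ x y → + 2 * (x * 1ℤ - y * -1ℤ) ≡ + 2 * (y + x)
  lem = solve-∀

D̄₀-odd-ratio : ∀ m → L m * D̄₀ (suc (m ℕ.* 2)) ≡ + 2 * (L (suc m) * -1ℤ ^ m) * D̄₀ (m ℕ.* 2)
D̄₀-odd-ratio m = begin
  L m * D̄₀ (suc (m ℕ.* 2))                             ≡⟨ cong (_* D̄₀ (suc (m ℕ.* 2))) (kernel-leading m) ⟨
  kernel m m * D̄₀ (suc (m ℕ.* 2))                      ≡⟨ even-step m (kernel m) (kernel-orthogonal m) ⟩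
  bCombination (suc m) (kernel m) m * D̄₀ (m ℕ.* 2)     ≡⟨ cong (_* D̄₀ (m ℕ.* 2)) (kernel-norm m) ⟩
  + 2 * (L (suc m) * -1ℤ ^ m) * D̄₀ (m ℕ.* 2)           ∎

D̄₁-ratio : ∀ m → L (suc m) * D̄₁ (suc m ℕ.* 2) ≡ kernel (suc m) 0 * D̄₀ (suc m ℕ.* 2)
D̄₁-ratio m = trans (cong (_* D̄₁ (suc m ℕ.* 2)) (sym (kernel-leading (suc m))))
  (even-shift m (kernel (suc m)) (kernel-orthogonal (suc m)))

D̄₀[4n+2]-ratio : ∀ n → D̄₀ (2 ℕ.+ n ℕ.* 2 ℕ.* 2) ≡ (- + 2) * D̄₀ (1 ℕ.+ n ℕ.* 2 ℕ.* 2)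
D̄₀[4n+2]-ratio n = begin
  D̄₀ (suc m ℕ.* 2)                                                  ≡⟨ ℤ.*-identityˡ (D̄₀ (suc m ℕ.* 2)) ⟨
  1ℤ * D̄₀ (suc m ℕ.* 2)                                             ≡⟨ cong (_* D̄₀ (suc m ℕ.* 2)) (evenKernel-leading n) ⟨
  evenKernel n m * D̄₀ (suc m ℕ.* 2)                                 ≡⟨ odd-step m (evenKernel n) (evenKernel-orthogonal n) ⟩
  bCombination (suc m) (evenKernel n) (suc m) * D̄₀ (suc (m ℕ.* 2))  ≡⟨ cong (_* D̄₀ (suc (m ℕ.* 2))) (evenKernel-norm n) ⟩
  (- + 2) * D̄₀ (suc (m ℕ.* 2))                                      ∎
  where
  m = n ℕ.* 2

D̄₀[4n+4]-ratio : ∀ n → L (1 ℕ.+ n ℕ.* 2) * D̄₀ (4 ℕ.+ n ℕ.* 2 ℕ.* 2) ≡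
                       + 2 * L (3 ℕ.+ n ℕ.* 2) * D̄₀ (3 ℕ.+ n ℕ.* 2 ℕ.* 2)
D̄₀[4n+4]-ratio n = begin
  L m * D̄₀ (suc m ℕ.* 2)                                            ≡⟨ cong (_* D̄₀ (suc m ℕ.* 2)) (oddKernel-leading n) ⟨
  oddKernel n m * D̄₀ (suc m ℕ.* 2)                                  ≡⟨ odd-step m (oddKernel n) (oddKernel-orthogonal n) ⟩
  bCombination (suc m) (oddKernel n) (suc m) * D̄₀ (suc (m ℕ.* 2))   ≡⟨ cong (_* D̄₀ (suc (m ℕ.* 2))) (oddKernel-norm n) ⟩
  + 2 * L (suc (suc m)) * D̄₀ (suc (m ℕ.* 2))                        ∎
  where
  m = suc (n ℕ.* 2)

-- Closed forms of the determinants

-- The factor 2 on the left avoids the exponent 4n - 1, which is negative for n = 0.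
D̄₀[4n] : ∀ n → + 2 * D̄₀ (n ℕ.* 2 ℕ.* 2) ≡ (+ 2) ^ (n ℕ.* 2 ℕ.* 2) * L (n ℕ.* 2) * L (1 ℕ.+ n ℕ.* 2)

-- The four formulas for `D̄₀` form one induction, each size following from the preceding one; the
-- successor clause of `D̄₀[4n]` closes the cycle.
D̄₀[4n+1] : ∀ n → D̄₀ (1 ℕ.+ n ℕ.* 2 ℕ.* 2) ≡ (+ 2) ^ (n ℕ.* 2 ℕ.* 2) * L (1 ℕ.+ n ℕ.* 2) ^ 2
D̄₀[4n+1] n = L-cancel (n ℕ.* 2) (begin
  p * D̄₀ (suc N)                          ≡⟨ D̄₀-odd-ratio (n ℕ.* 2) ⟩
  + 2 * (q * -1ℤ ^ (n ℕ.* 2)) * D̄₀ N      ≡⟨ cong (λ s → + 2 * (q * s) * D̄₀ N) (-1^even n) ⟩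
  + 2 * (q * 1ℤ) * D̄₀ N                   ≡⟨ factor q (D̄₀ N) ⟩
  q * (+ 2 * D̄₀ N)                        ≡⟨ cong (q *_) (D̄₀[4n] n) ⟩
  q * ((+ 2) ^ N * p * q)                   ≡⟨ lem p q ((+ 2) ^ N) ⟩
  p * ((+ 2) ^ N * q ^ 2)                   ∎)
  where
  N = n ℕ.* 2 ℕ.* 2
  p = L (n ℕ.* 2)
  q = L (1 ℕ.+ n ℕ.* 2)
  factor : ∀ q d → + 2 * (q * 1ℤ) * d ≡ q * (+ 2 * d)
  factor = solve-∀
  lem : ∀ p q t → q * (t * p * q) ≡ p * (t * (q * (q * 1ℤ)))
  lem = solve-∀

D̄₀[4n+2] : ∀ n → D̄₀ (2 ℕ.+ n ℕ.* 2 ℕ.* 2) ≡ - ((+ 2) ^ (1 ℕ.+ n ℕ.* 2 ℕ.* 2) * L (1 ℕ.+ n ℕ.* 2) ^ 2)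
D̄₀[4n+2] n = begin
  D̄₀ (2 ℕ.+ N)                   ≡⟨ D̄₀[4n+2]-ratio n ⟩
  (- + 2) * D̄₀ (1 ℕ.+ N)         ≡⟨ cong ((- + 2) *_) (D̄₀[4n+1] n) ⟩
  (- + 2) * ((+ 2) ^ N * q ^ 2)    ≡⟨ lem ((+ 2) ^ N) (q ^ 2) ⟩
  - ((+ 2) ^ (1 ℕ.+ N) * q ^ 2)    ∎
  where
  N = n ℕ.* 2 ℕ.* 2
  q = L (1 ℕ.+ n ℕ.* 2)
  lem : ∀ t x → (- + 2) * (t * x) ≡ - (+ 2 * t * x)
  lem = solve-∀

D̄₀[4n+3] : ∀ n → D̄₀ (3 ℕ.+ n ℕ.* 2 ℕ.* 2) ≡ (+ 2) ^ (2 ℕ.+ n ℕ.* 2 ℕ.* 2) * L (1 ℕ.+ n ℕ.* 2) * L (2 ℕ.+ n ℕ.* 2)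
D̄₀[4n+3] n = L-cancel (1 ℕ.+ n ℕ.* 2) (begin
  p * D̄₀ (3 ℕ.+ N)
    ≡⟨ D̄₀-odd-ratio (1 ℕ.+ n ℕ.* 2) ⟩
  + 2 * (q * -1ℤ ^ (1 ℕ.+ n ℕ.* 2)) * D̄₀ (2 ℕ.+ N)
    ≡⟨ cong₂ (λ s d → + 2 * (q * (-1ℤ * s)) * d) (-1^even n) (D̄₀[4n+2] n) ⟩
  + 2 * (q * (-1ℤ * 1ℤ)) * (- ((+ 2) ^ (1 ℕ.+ N) * p ^ 2))
    ≡⟨ lem p q ((+ 2) ^ (1 ℕ.+ N)) ⟩
  p * ((+ 2) ^ (2 ℕ.+ N) * p * q) ∎)
  where
  N = n ℕ.* 2 ℕ.* 2
  p = L (1 ℕ.+ n ℕ.* 2)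
  q = L (2 ℕ.+ n ℕ.* 2)
  lem : ∀ p q t → + 2 * (q * (-1ℤ * 1ℤ)) * (- (t * (p * (p * 1ℤ)))) ≡ p * (+ 2 * t * p * q)
  lem = solve-∀

D̄₀[4n] zero    = refl
D̄₀[4n] (suc n) = L-cancel (1 ℕ.+ n ℕ.* 2) (begin
  p * (+ 2 * D̄₀ (4 ℕ.+ N))                   ≡⟨ factor p (D̄₀ (4 ℕ.+ N)) ⟩
  + 2 * (p * D̄₀ (4 ℕ.+ N))                   ≡⟨ cong (+ 2 *_) (D̄₀[4n+4]-ratio n) ⟩
  + 2 * (+ 2 * r * D̄₀ (3 ℕ.+ N))             ≡⟨ cong (λ d → + 2 * (+ 2 * r * d)) (D̄₀[4n+3] n) ⟩
  + 2 * (+ 2 * r * (t * p * q))              ≡⟨ lem p q r t ⟩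
  p * ((+ 2) ^ (4 ℕ.+ N) * q * r)              ∎)
  where
  N = n ℕ.* 2 ℕ.* 2
  p = L (1 ℕ.+ n ℕ.* 2)
  q = L (2 ℕ.+ n ℕ.* 2)
  r = L (3 ℕ.+ n ℕ.* 2)
  t = (+ 2) ^ (2 ℕ.+ N)
  factor : ∀ p d → p * (+ 2 * d) ≡ + 2 * (p * d)
  factor = solve-∀
  lem : ∀ p q r t → + 2 * (+ 2 * r * (t * p * q)) ≡ p * (+ 2 * (+ 2 * t) * q * r)
  lem = solve-∀

D̄₁[4n] : ∀ n → D̄₁ (n ℕ.* 2 ℕ.* 2) ≡ (+ 2) ^ (n ℕ.* 2 ℕ.* 2) * L (1 ℕ.+ n ℕ.* 2) ^ 2
-- `D̄₁-ratio` covers only positive sizes.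
D̄₁[4n] zero    = refl
D̄₁[4n] (suc n) = L-cancel (suc n ℕ.* 2) (begin
  p * D̄₁ N                                ≡⟨ D̄₁-ratio (1 ℕ.+ n ℕ.* 2) ⟩
  kernel (suc n ℕ.* 2) 0 * D̄₀ N           ≡⟨ cong (_* D̄₀ N) (kernel-constant-even (suc n)) ⟩
  + 2 * q * D̄₀ N                          ≡⟨ factor q (D̄₀ N) ⟩
  q * (+ 2 * D̄₀ N)                        ≡⟨ cong (q *_) (D̄₀[4n] (suc n)) ⟩
  q * ((+ 2) ^ N * p * q)                   ≡⟨ lem p q ((+ 2) ^ N) ⟩
  p * ((+ 2) ^ N * q ^ 2)                   ∎)
  where
  N = suc n ℕ.* 2 ℕ.* 2
  p = L (suc n ℕ.* 2)
  q = L (1 ℕ.+ suc n ℕ.* 2)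
  factor : ∀ q d → + 2 * q * d ≡ q * (+ 2 * d)
  factor = solve-∀
  lem : ∀ p q t → q * (t * p * q) ≡ p * (t * (q * (q * 1ℤ)))
  lem = solve-∀

D̄₁[4n+2] : ∀ n → D̄₁ (2 ℕ.+ n ℕ.* 2 ℕ.* 2) ≡ - ((+ 2) ^ (2 ℕ.+ n ℕ.* 2 ℕ.* 2) * L (1 ℕ.+ n ℕ.* 2) ^ 2)
D̄₁[4n+2] n = L-cancel (1 ℕ.+ n ℕ.* 2) (begin
  p * D̄₁ (2 ℕ.+ N)                             ≡⟨ D̄₁-ratio (n ℕ.* 2) ⟩
  kernel (1 ℕ.+ n ℕ.* 2) 0 * D̄₀ (2 ℕ.+ N)      ≡⟨ cong₂ _*_ (kernel-constant-odd n) (D̄₀[4n+2] n) ⟩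
  + 2 * p * (- ((+ 2) ^ (1 ℕ.+ N) * p ^ 2))      ≡⟨ lem p ((+ 2) ^ (1 ℕ.+ N)) (p ^ 2) ⟩
  p * (- ((+ 2) ^ (2 ℕ.+ N) * p ^ 2))            ∎)
  where
  N = n ℕ.* 2 ℕ.* 2
  p = L (1 ℕ.+ n ℕ.* 2)
  lem : ∀ p t x → + 2 * p * (- (t * x)) ≡ p * (- (+ 2 * t * x))
  lem = solve-∀

-- The parity of n decides which kernel is orthogonal for x (1 + x); its nonzero leading coefficient
-- is then cancelled.
D̄₁[2n+1] : ∀ n → D̄₁ (1 ℕ.+ n ℕ.* 2) ≡ 0ℤ
D̄₁[2n+1] n with halve n
... | even r = begin
  D̄₁ N                            ≡⟨ ℤ.*-identityˡ (D̄₁ N) ⟨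
  1ℤ * D̄₁ N                       ≡⟨ cong (_* D̄₁ N) (evenKernel-leading r) ⟨
  evenKernel r (r ℕ.* 2) * D̄₁ N   ≡⟨ odd-shift (r ℕ.* 2) (evenKernel r) (evenKernel-orthogonal r) ⟩
  0ℤ                              ∎
  where
  N = 1 ℕ.+ r ℕ.* 2 ℕ.* 2
... | odd r = L-cancel (1 ℕ.+ r ℕ.* 2) (begin
  p * D̄₁ N                              ≡⟨ cong (_* D̄₁ N) (oddKernel-leading r) ⟨
  oddKernel r (suc (r ℕ.* 2)) * D̄₁ N    ≡⟨ odd-shift (suc (r ℕ.* 2)) (oddKernel r) (oddKernel-orthogonal r) ⟩
  0ℤ                                    ≡⟨ ℤ.*-zeroʳ p ⟨
  p * 0ℤ                                ∎)
  where
  N = 3 ℕ.+ r ℕ.* 2 ℕ.* 2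
  p = L (suc (r ℕ.* 2))

-- Passage to rational powers of 2

toℚ-* : ∀ i j → toℚ (i * j) ≡ toℚ i ℚ.* toℚ j
toℚ-* i j = ℚ.toℚᵘ-injective (ℚᵘ.≃-trans (ℚ.toℚᵘ-fromℚᵘ (mkℚᵘ (i * j) 0)) (ℚᵘ.≃-sym
  (ℚᵘ.≃-trans (ℚ.toℚᵘ-homo-* (toℚ i) (toℚ j))
    (ℚᵘ.*-cong (ℚ.toℚᵘ-fromℚᵘ (mkℚᵘ i 0)) (ℚ.toℚᵘ-fromℚᵘ (mkℚᵘ j 0))))))

+2^ : ∀ n → + (2 ℕ.^ n) ≡ (+ 2) ^ n
+2^ zero    = refl
+2^ (suc n) = trans (ℤ.pos-* 2 (2 ℕ.^ n)) (cong (+ 2 *_) (+2^ n))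

D̄₀[4n]-rational : ∀ n → toℚ (D̄₀ (n ℕ.* 2 ℕ.* 2)) ≡
  2^ (+ (n ℕ.* 2 ℕ.* 2) - + 1) ℚ.* toℚ (L (n ℕ.* 2)) ℚ.* toℚ (L (1 ℕ.+ n ℕ.* 2))
-- Exponent -1: both sides compute to 1.
D̄₀[4n]-rational zero    = refl
D̄₀[4n]-rational (suc n) = begin
  toℚ (D̄₀ (4 ℕ.+ N))                         ≡⟨ cong toℚ halved ⟩
  toℚ (+ (2 ℕ.^ (3 ℕ.+ N)) * p * q)          ≡⟨ toℚ-* (+ (2 ℕ.^ (3 ℕ.+ N)) * p) q ⟩
  toℚ (+ (2 ℕ.^ (3 ℕ.+ N)) * p) ℚ.* toℚ q    ≡⟨ cong (ℚ._* toℚ q) (toℚ-* (+ (2 ℕ.^ (3 ℕ.+ N))) p) ⟩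
  2^ (+ (3 ℕ.+ N)) ℚ.* toℚ p ℚ.* toℚ q       ∎
  where
  N = n ℕ.* 2 ℕ.* 2
  p = L (suc n ℕ.* 2)
  q = L (1 ℕ.+ suc n ℕ.* 2)
  lem : ∀ t p q → + 2 * t * p * q ≡ + 2 * (t * p * q)
  lem = solve-∀
  halved : D̄₀ (4 ℕ.+ N) ≡ + (2 ℕ.^ (3 ℕ.+ N)) * p * q
  halved = ℤ.*-cancelˡ-≡ (+ 2) _ _ (trans (D̄₀[4n] (suc n))
    (trans (lem ((+ 2) ^ (3 ℕ.+ N)) p q) (cong (λ t → + 2 * (t * p * q)) (sym (+2^ (3 ℕ.+ N))))))

theorem2p4 : ∀ (n : ℕ) →
    (toℚ (D̄₀ (4 ℕ.* n)) ≡ 2^ (+ (4 ℕ.* n) - + 1) ℚ.* toℚ (L (2 ℕ.* n)) ℚ.* toℚ (L (2 ℕ.* n ℕ.+ 1)))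
    × (D̄₀ (4 ℕ.* n ℕ.+ 1) ≡ (+ 2) ^ (4 ℕ.* n) * L (2 ℕ.* n ℕ.+ 1) ^ 2)
    × (D̄₀ (4 ℕ.* n ℕ.+ 2) ≡ - ((+ 2) ^ (4 ℕ.* n ℕ.+ 1) * L (2 ℕ.* n ℕ.+ 1) ^ 2))
    × (D̄₀ (4 ℕ.* n ℕ.+ 3) ≡ (+ 2) ^ (4 ℕ.* n ℕ.+ 2) * L (2 ℕ.* n ℕ.+ 1) * L (2 ℕ.* n ℕ.+ 2))
    × (D̄₁ (2 ℕ.* n ℕ.+ 1) ≡ 0ℤ)
    × (D̄₁ (4 ℕ.* n) ≡ (+ 2) ^ (4 ℕ.* n) * L (2 ℕ.* n ℕ.+ 1) ^ 2)
    × (D̄₁ (4 ℕ.* n ℕ.+ 2) ≡ - ((+ 2) ^ (4 ℕ.* n ℕ.+ 2) * L (2 ℕ.* n ℕ.+ 1) ^ 2))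
theorem2p4 n
  -- Indices are brought to the form `k + n * 2 * 2` or `k + n * 2`, in which the constants compute.
  rewrite trans (ℕ.*-comm 4 n) (sym (ℕ.*-assoc n 2 2)) | ℕ.*-comm 2 n
        | ℕ.+-comm (n ℕ.* 2 ℕ.* 2) 1 | ℕ.+-comm (n ℕ.* 2 ℕ.* 2) 2 | ℕ.+-comm (n ℕ.* 2 ℕ.* 2) 3
        | ℕ.+-comm (n ℕ.* 2) 1 | ℕ.+-comm (n ℕ.* 2) 2
  = D̄₀[4n]-rational n , D̄₀[4n+1] n , D̄₀[4n+2] n , D̄₀[4n+3] n , D̄₁[2n+1] n , D̄₁[4n] n , D̄₁[4n+2] n
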